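{- Let $P=(X,\prec)$ be a finite twin-free interval order. The following are equivalent: (1) $P$ is a unit OC interval order; (2) $P$ is a strict OC interval order; (3) $P$ has no induced subposet isomorphic to any of $\mathbf{4}+\mathbf{1}$, $\mathbf{3}+\mathbf{1}+\mathbf{1}$, $Z$, $D$, $Y$, or the dual of $Y$.
   Context: Posets are strict partial orders on a finite set; a poset $Q$ is induced in $P$ if it is isomorphic to the restriction of $P$ to some subset. $P$ is an interval order if each $x$ can be assigned a closed real interval $[L(x),R(x)]$ with $x\prec y$ iff $R(x)<L(y)$. An OC interval representation of $P$ assigns to each $x\in X$ a real interval $I(x)$ that is either open or closed, so that $x\prec y$ iff every point of $I(x)$ is less than every point of $I(y)$. $P$ is a unit OC interval order if it has an OC interval representation with all intervals of the same length. An interval $I(u)$ is strictly contained in $I(v)$ if $I(u)\subset I(v)$ and they do not have identical endpoints; an OC interval representation is strict if no interval is strictly contained in another, and $P$ is a strict OC interval order if it has a strict OC interval representation. Twins are two elements with exactly the same comparabilities; twin-free means no twins. The posets (listed comparabilities plus transitive consequences, all other pairs incomparable): $\mathbf{4}+\mathbf{1}$ on $\{a,b,c,d,x\}$ with $a\prec b\prec c\prec d$; $\mathbf{3}+\mathbf{1}+\mathbf{1}$ on $\{a,b,c,x,y\}$ with $a\prec b\prec c$; $Z$ on $\{a,b,c,d,x,y\}$ with $a\prec b\prec c\prec d$, $x\prec d$, $a\prec y$; $D$ on $\{a,b,c,d,x\}$ with $a\prec b\prec d$, $a\prec c\prec d$; $Y$ on $\{a,b,c,d,x\}$ with $a\prec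 d\prec b$, $a\prec d\prec c$. The dual reverses all comparabilities.
   Formalization: The endpoints of all intervals (in the interval order and in the OC representations), their points and the common length are rational numbers instead of real numbers. -}

module Defs where

open import Data.Nat using (ℕ)
open import Data.Fin using (Fin)
open import Data.Fin.Patterns
open import Data.Bool using (Bool; true; false)
open import Data.Rational using (ℚ; _<_; _≤_; _-_)
open import Data.Product using (Σ; _×_; ∃)
open import Relation.Nullary using (¬_)
open import Relation.Binary.PropositionalEquality using (_≡_; _≢_)
open import Function.Bundles using (_⇔_)

record FinPoset : Set₁ where
  field
    size  : ℕ
    _≺_   : Fin size → Fin size → Set
    irrefl : ∀ x → ¬ (x ≺ x)
    trans  : ∀ {x y z} → x ≺ y → y ≺ z → x ≺ z
open FinPoset public

Elt : FinPoset → Set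
Elt P = Fin (size P)

IsIntervalOrder : FinPoset → Set
IsIntervalOrder P =
  Σ (Elt P → ℚ) λ L → Σ (Elt P → ℚ) λ R →
    (∀ x → L x ≤ R x) × (∀ x y → (_≺_ P x y) ⇔ (R x < L y))

record OCInterval : Set where
  field
    left   : ℚ
    right  : ℚ
    isOpen : Bool
    nonempty : (isOpen ≡ true → left < right) × (isOpen ≡ false → left ≤ right)
open OCInterval public

_∈I_ : ℚ → OCInterval → Set
p ∈I I with isOpen I
... | true  = (left I < p) × (p < right I)
... | false = (left I ≤ p) × (p ≤ right I)

_≪_ : OCInterval → OCInterval → Set
I ≪ J = ∀ p q → p ∈I I → q ∈I J → p < q

length : OCInterval → ℚ
length I = right I - left I

_⊆I_ : OCInterval → OCInterval → Set
I ⊆I J = ∀ p → p ∈I I → p ∈I J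

StrictlyContained : OCInterval → OCInterval → Set
StrictlyContained I J = I ⊆I J × ¬ ((left I ≡ left J) × (right I ≡ right J))

IsOCRepresentation : (P : FinPoset) → (Elt P → OCInterval) → Set
IsOCRepresentation P I = ∀ x y → (_≺_ P x y) ⇔ (I x ≪ I y)

IsUnitOCIntervalOrder : FinPoset → Set
IsUnitOCIntervalOrder P =
  Σ (Elt P → OCInterval) λ I → IsOCRepresentation P I ×
    Σ ℚ λ ℓ → ∀ x → length (I x) ≡ ℓ

IsStrictOCIntervalOrder : FinPoset → Set
IsStrictOCIntervalOrder P =
  Σ (Elt P → OCInterval) λ I → IsOCRepresentation P I ×
    (∀ u v → ¬ StrictlyContained (I u) (I v))

Twins : (P : FinPoset) → Elt P → Elt P → Set
Twins P x y = x ≢ y ×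
  (∀ z → ((_≺_ P z x) ⇔ (_≺_ P z y)) × ((_≺_ P x z) ⇔ (_≺_ P y z)))

TwinFree : FinPoset → Set
TwinFree P = ∀ x y → ¬ Twins P x y

data TC {m : ℕ} (G : Fin m → Fin m → Set) : Fin m → Fin m → Set where
  gen  : ∀ {x y} → G x y → TC G x y
  step : ∀ {x y z} → TC G x y → TC G y z → TC G x z

Dual : {m : ℕ} → (Fin m → Fin m → Set) → Fin m → Fin m → Set
Dual R x y = R y x

data G-4+1 : Fin 5 → Fin 5 → Set where
  ab : G-4+1 0F 1F
  bc : G-4+1 1F 2F
  cd : G-4+1 2F 3F

data G-3+1+1 : Fin 5 → Fin 5 → Set where
  ab : G-3+1+1 0F 1F
  bc : G-3+1+1 1F 2F

data G-Z : Fin 6 → Fin 6 → Set where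
  ab : G-Z 0F 1F
  bc : G-Z 1F 2F
  cd : G-Z 2F 3F
  xd : G-Z 4F 3F
  ay : G-Z 0F 5F

data G-D : Fin 5 → Fin 5 → Set where
  ab : G-D 0F 1F
  bd : G-D 1F 3F
  ac : G-D 0F 2F
  cd : G-D 2F 3F

data G-Y : Fin 5 → Fin 5 → Set where
  ad : G-Y 0F 3F
  db : G-Y 3F 1F
  dc : G-Y 3F 2F

Four+One ThreeOneOne PosetD PosetY PosetYDual : Fin 5 → Fin 5 → Set
Four+One    = TC G-4+1
ThreeOneOne = TC G-3+1+1
PosetD      = TC G-D
PosetY      = TC G-Y
PosetYDual  = Dual (TC G-Y)

PosetZ : Fin 6 → Fin 6 → Set
PosetZ = TC G-Z

HasInduced : (P : FinPoset) {m : ℕ} → (Fin m → Fin m → Set) → Set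
HasInduced P {m} Q =
  Σ (Fin m → Elt P) λ f → (∀ i j → f i ≡ f j → i ≡ j) ×
    (∀ i j → Q i j ⇔ (_≺_ P (f i) (f j)))

ForbiddenFree : FinPoset → Set
ForbiddenFree P =
  ¬ HasInduced P Four+One × ¬ HasInduced P ThreeOneOne × ¬ HasInduced P PosetZ ×
  ¬ HasInduced P PosetD × ¬ HasInduced P PosetY × ¬ HasInduced P PosetYDual

{-# OPTIONS --safe #-}

-- A spanned element b of a 3+1 (a ≺ b ≺ c, spanned by x) must, in a strict
-- representation, be an open interval with the endpoints of the closed interval
-- x, while a ends and c begins exactly at those endpoints.  Two elements pinned
-- to the same data are twins, and each forbidden poset forces such a coincidence
-- or an interval that is both open and closed.
--
-- Conversely, call the spanned elements middles.  Without the forbidden posets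
-- every middle has a unique spanner, no spanner is a middle, and the non-middles
-- are linearly ordered by their sets of predecessors and successors.  Closed
-- unit intervals for them are placed greedily in this order, two of them touching
-- exactly where a middle requires it; each middle becomes the open interval with
-- the endpoints of its spanner.
module Submission where

open import Defs
open import Data.Bool as Bool using (Bool; true; false)
open import Data.Bool.Properties using (¬-not; not-¬)
open import Data.Empty using (⊥)
open import Data.Fin using (Fin; _≟_)
open import Data.Fin.Patterns
open import Data.Fin.Properties using (any?)
open import Data.Fin.Subset using (∣_∣) renaming (_∈_ to _∈ₛ_)
open import Data.Fin.Subset.Properties using (∣p∣≤n; p⊆q⇒∣p∣≤∣q∣; p⊂q⇒∣p∣<∣q∣)
open import Data.List using (List; []; _∷_; filter; allFin; map)
open import Data.List.Membership.Propositional using (_∈_)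
open import Data.List.Membership.Propositional.Properties
  using (∈-map⁺; ∈-map⁻; ∈-filter⁺; ∈-filter⁻; ∈-allFin)
open import Data.List.Relation.Unary.All as All using (All; []; _∷_)
open import Data.List.Relation.Unary.AllPairs using (AllPairs; []; _∷_)
open import Data.List.Relation.Unary.Any using (here; there)
open import Data.Nat as ℕ using (ℕ; zero; suc)
import Data.Nat.Properties as ℕ
open import Data.Product using (_×_; _,_; ∃; ∃-syntax; proj₁; proj₂)
open import Data.Rational as ℚ using (ℚ; _<_; _≤_; 0ℚ; 1ℚ; _+_; _-_; -_; _<?_; _≤?_)
import Data.Rational.Properties as ℚ
open import Data.Sum as Sum using (_⊎_; inj₁; inj₂)
open import Data.Vec using ([]; _∷_; lookup; tabulate)
open import Data.Vec.Functional using (updateAt)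
open import Data.Vec.Functional.Properties using (updateAt-updates; updateAt-minimal)
open import Data.Vec.Properties using (lookup⇒[]=; []=⇒lookup; lookup∘tabulate)
open import Function using (_∘_; flip; case_of_)
open import Function.Bundles using (_⇔_; mk⇔; Equivalence)
open import Level using (0ℓ)
open import Relation.Binary.Core using (Rel)
open import Relation.Binary.Definitions using (Decidable; Symmetric)
open import Relation.Binary.PropositionalEquality
  using (_≡_; _≢_; refl; sym; cong; subst; module ≡-Reasoning) renaming (trans to ≡-trans)
open import Relation.Nullary using (¬_; Dec; yes; no; does; contradiction)
open import Relation.Nullary.Decidable
  using (map′; _×-dec_; _⊎-dec_; ¬?; decidable-stable; dec-true)
open import Relation.Unary as Unary using (Pred)
open Equivalence using (to; from)

-- Cardinalities of decidable subsets of a finite set.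

module _ {n} {P : Pred (Fin n) 0ℓ} (P? : Unary.Decidable P) where

  count : ℕ
  count = ∣ tabulate (does ∘ P?) ∣

  count≤n : count ℕ.≤ n
  count≤n = ∣p∣≤n (tabulate (does ∘ P?))

  tabulate-∈⁺ : ∀ {x} → P x → x ∈ₛ tabulate (does ∘ P?)
  tabulate-∈⁺ {x} px =
    lookup⇒[]= x _ (≡-trans (lookup∘tabulate (does ∘ P?) x) (dec-true (P? x) px))

  tabulate-∈⁻ : ∀ {x} → x ∈ₛ tabulate (does ∘ P?) → P x
  tabulate-∈⁻ {x} x∈ with P? x in eq
  ... | yes px = px
  ... | no  _  with () ← ≡-trans (sym (≡-trans (lookup∘tabulate (does ∘ P?) x) (cong does eq))) ([]=⇒lookup x∈)

module _ {n} {P Q : Pred (Fin n) 0ℓ} (P? : Unary.Decidable P) (Q? : Unary.Decidable Q)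
         (P⊆Q : ∀ {x} → P x → Q x) where

  count-mono : count P? ℕ.≤ count Q?
  count-mono = p⊆q⇒∣p∣≤∣q∣ (tabulate-∈⁺ Q? ∘ P⊆Q ∘ tabulate-∈⁻ P?)

  count-strict : ∀ {x} → Q x → ¬ P x → count P? ℕ.< count Q?
  count-strict qx ¬px = p⊂q⇒∣p∣<∣q∣
    ( tabulate-∈⁺ Q? ∘ P⊆Q ∘ tabulate-∈⁻ P?
    , (_ , tabulate-∈⁺ Q? qx , ¬px ∘ tabulate-∈⁻ P?))

-- Spans and the order of the closed elements

module _ {n} (_⊏_ : Rel (Fin n) 0ℓ) where

  -- The 3+1 pattern: by transitivity alone, x is incomparable to a, b and c.
  record Spans (a b c x : Fin n) : Set where
    constructor spans
    field
      a⊏b : a ⊏ b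
      b⊏c : b ⊏ c
      a⋢x : ¬ a ⊏ x
      x⋢c : ¬ x ⊏ c

  Middle : Fin n → Set
  Middle b = ∃[ a ] ∃[ c ] ∃[ x ] Spans a b c x

  -- In a unit representation with the middles open and the others closed, the
  -- right endpoint of u is the left endpoint of v.
  Touch : Rel (Fin n) 0ℓ
  Touch u v = (∃[ b ] ∃[ c ] Spans u b c v) ⊎ (∃[ a ] ∃[ b ] Spans a b v u)

  -- In interval terms, `z` witnesses that `u` begins, or that `u` ends, before `v` does. A middle
  -- and its spanner are related in both directions, so asymmetry needs the middles to be left out.
  Before : Rel (Fin n) 0ℓ
  Before u v = (∃[ z ] (z ⊏ v × ¬ z ⊏ u)) ⊎ (∃[ z ] (u ⊏ z × ¬ v ⊏ z))

  -- `ferrers` excludes an induced 2+2, the combinatorial mark of interval orders. All fields are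
  -- self-dual, so every result can be reflected.
  record FerrersOrder : Set where
    field
      _⊏?_     : Decidable _⊏_
      ⊏-irrefl : ∀ {x} → ¬ x ⊏ x
      ⊏-trans  : ∀ {x y z} → x ⊏ y → y ⊏ z → x ⊏ z
      ferrers  : ∀ {u v w z} → u ⊏ v → w ⊏ z → u ⊏ z ⊎ w ⊏ v

  -- The last four fields exclude 3+1+1, D, Y and the dual of Y; the first one
  -- excludes both 4+1 (x and y may coincide) and Z.
  record SpanAxioms : Set where
    field
      ferrersOrder   : FerrersOrder
      unchained      : ∀ {a b c d x y} → Spans a b c x → Spans b c d y → ⊥
      spanner-unique : ∀ {a b c x y} → Spans a b c x → Spans a b c y → x ≡ y
      middle-unique  : ∀ {a b b′ c x} → Spans a b c x → Spans a b′ c x → b ≡ b′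
      top-unique     : ∀ {a b c c′ x} → Spans a b c x → Spans a b c′ x → c ≡ c′
      bottom-unique  : ∀ {a a′ b c x} → Spans a b c x → Spans a′ b c x → a ≡ a′

    open FerrersOrder ferrersOrder public

module _ {n} {_⊏_ : Rel (Fin n) 0ℓ} (F : FerrersOrder _⊏_) where
  open FerrersOrder F

  before? : Decidable (Before _⊏_)
  before? u v = any? (λ z → (z ⊏? v) ×-dec ¬? (z ⊏? u)) ⊎-dec any? (λ z → (u ⊏? z) ×-dec ¬? (v ⊏? z))

module _ {n} {_⊏_ : Rel (Fin n) 0ℓ} where

  flip-spans : ∀ {a b c x} → Spans _⊏_ a b c x → Spans (flip _⊏_) c b a x
  flip-spans (spans p q r s) = spans q p s r

  flip-touch : ∀ {u v} → Touch _⊏_ u v → Touch (flip _⊏_) v u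
  flip-touch (inj₁ (b , c , s)) = inj₂ (c , b , flip-spans s)
  flip-touch (inj₂ (a , b , s)) = inj₁ (b , a , flip-spans s)

module _ {n} {_⊏_ : Rel (Fin n) 0ℓ} where

  flip-middle : ∀ {b} → Middle (flip _⊏_) b → Middle _⊏_ b
  flip-middle (a , c , x , s) = c , a , x , flip-spans s

  flip-ferrers : FerrersOrder _⊏_ → FerrersOrder (flip _⊏_)
  flip-ferrers F = record
    { _⊏?_     = flip _⊏?_
    ; ⊏-irrefl = ⊏-irrefl
    ; ⊏-trans  = flip ⊏-trans
    ; ferrers  = λ p q → ferrers q p
    } where open FerrersOrder F

  flip-axioms : SpanAxioms _⊏_ → SpanAxioms (flip _⊏_)
  flip-axioms A = record
    { ferrersOrder   = flip-ferrers ferrersOrder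
    ; unchained      = λ s t → unchained (flip-spans t) (flip-spans s)
    ; spanner-unique = λ s t → spanner-unique (flip-spans s) (flip-spans t)
    ; middle-unique  = λ s t → middle-unique (flip-spans s) (flip-spans t)
    ; top-unique     = λ s t → bottom-unique (flip-spans s) (flip-spans t)
    ; bottom-unique  = λ s t → top-unique (flip-spans s) (flip-spans t)
    } where open SpanAxioms A

module SpanTheory {n} {_⊏_ : Rel (Fin n) 0ℓ} (A : SpanAxioms _⊏_) where
  open SpanAxioms A

  spans? : ∀ a b c x → Dec (Spans _⊏_ a b c x)
  spans? a b c x = map′
    (λ ((p , q) , (r , s)) → spans p q r s) (λ (spans p q r s) → (p , q) , (r , s))
    (((a ⊏? b) ×-dec (b ⊏? c)) ×-dec (¬? (a ⊏? x) ×-dec ¬? (x ⊏? c)))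

  middle? : Unary.Decidable (Middle _⊏_)
  middle? b = any? λ a → any? λ c → any? λ x → spans? a b c x

  touch? : Decidable (Touch _⊏_)
  touch? u v = any? (λ b → any? λ c → spans? u b c v) ⊎-dec any? (λ a → any? λ b → spans? a b v u)

  Closed : Fin n → Set
  Closed v = ¬ Middle _⊏_ v

  closed? : Unary.Decidable Closed
  closed? v = ¬? (middle? v)

  -- `ferrers` exchanges bottoms and tops until both chains run between the same two elements; then
  -- `middle-unique` applies.
  spanned-unique : ∀ {a a′ b b′ c c′ x} → Spans _⊏_ a b c x → Spans _⊏_ a′ b′ c′ x → b ≡ b′
  spanned-unique (spans p q r s) (spans p′ q′ r′ s′) with ferrers p p′ | ferrers q q′
  ... | inj₁ a⊏b′ | inj₁ b⊏c′ = middle-unique (spans p b⊏c′ r s′) (spans a⊏b′ q′ r s′)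
  ... | inj₁ a⊏b′ | inj₂ b′⊏c = middle-unique (spans p q r s) (spans a⊏b′ b′⊏c r s)
  ... | inj₂ a′⊏b | inj₁ b⊏c′ = middle-unique (spans a′⊏b b⊏c′ r′ s′) (spans p′ q′ r′ s′)
  ... | inj₂ a′⊏b | inj₂ b′⊏c = middle-unique (spans a′⊏b q r′ s) (spans p′ b′⊏c r′ s)

  ⊏-spanned : ∀ {a b c x u} → Spans _⊏_ a b c x → u ⊏ x → u ⊏ b
  ⊏-spanned (spans p _ r _) u⊏x with ferrers p u⊏x
  ... | inj₁ a⊏x = contradiction a⊏x r
  ... | inj₂ u⊏b = u⊏b

  spanned-⊏ : ∀ {a b c x u} → Spans _⊏_ a b c x → x ⊏ u → b ⊏ u
  spanned-⊏ (spans _ q _ s) x⊏u with ferrers q x⊏u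
  ... | inj₁ b⊏u = b⊏u
  ... | inj₂ x⊏c = contradiction x⊏c s

  -- If `x` were itself spanned, `b` would fit between the same bottom and top under the same
  -- spanner. Then `b` would equal `x`, although `a` is below `b` and not below `x`.
  spanner-closed : ∀ {a b c x} → Spans _⊏_ a b c x → Closed x
  spanner-closed s@(spans a⊏b _ a⋢x _) (_ , _ , _ , spans p q r t)
    with refl ← middle-unique (spans (⊏-spanned s p) (spanned-⊏ s q) r t) (spans p q r t)
    = a⋢x a⊏b

  -- Two witnesses of the same kind contradict `ferrers`. Witnesses of different kinds are the
  -- bottom and top of a span in which one of `u`, `v` is the middle and the other its spanner.
  before-asym : ∀ {u v} → Closed u → Closed v → Before _⊏_ u v → ¬ Before _⊏_ v u
  before-asym _ _ (inj₁ (_ , p , ¬p)) (inj₁ (_ , q , ¬q)) = Sum.[ ¬p , ¬q ] (ferrers p q)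
  before-asym _ cv (inj₁ (_ , p , ¬p)) (inj₂ (_ , q , ¬q)) = cv (_ , _ , _ , spans p q ¬p ¬q)
  before-asym cu _ (inj₂ (_ , p , ¬p)) (inj₁ (_ , q , ¬q)) = cu (_ , _ , _ , spans q p ¬q ¬p)
  before-asym _ _ (inj₂ (_ , p , ¬p)) (inj₂ (_ , q , ¬q)) = Sum.[ ¬q , ¬p ] (ferrers p q)

  before-irrefl : ∀ {u} → ¬ Before _⊏_ u u
  before-irrefl (inj₁ (_ , p , ¬p)) = ¬p p
  before-irrefl (inj₂ (_ , p , ¬p)) = ¬p p

  module _ {u v} (cu : Closed u) (cv : Closed v) (u◁v : Before _⊏_ u v) where

    below-mono : ∀ {z} → z ⊏ u → z ⊏ v
    below-mono p = decidable-stable (_ ⊏? _) λ ¬q → before-asym cu cv u◁v (inj₁ (_ , p , ¬q))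

    above-anti : ∀ {z} → v ⊏ z → u ⊏ z
    above-anti p = decidable-stable (_ ⊏? _) λ ¬q → before-asym cu cv u◁v (inj₂ (_ , p , ¬q))

  ⊏⇒before : ∀ {u v} → u ⊏ v → Before _⊏_ u v
  ⊏⇒before p = inj₁ (_ , p , ⊏-irrefl)

  touch⇒before : ∀ {u v} → Touch _⊏_ u v → Before _⊏_ u v
  touch⇒before (inj₁ (_ , _ , spans p q _ s)) = inj₂ (_ , p , λ v⊏b → s (⊏-trans v⊏b q))
  touch⇒before (inj₂ (_ , _ , spans p q r _)) = inj₁ (_ , q , λ b⊏u → r (⊏-trans p b⊏u))

  touch⇒⋢ : ∀ {u v} → Touch _⊏_ u v → ¬ u ⊏ v
  touch⇒⋢ (inj₁ (_ , _ , spans _ _ r _)) = r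
  touch⇒⋢ (inj₂ (_ , _ , spans _ _ _ s)) = s

  -- Otherwise `u` could replace `v` in the span behind the touch, as its bottom or as its spanner,
  -- and uniqueness would identify the two.
  before-touch : ∀ {u v w} → Closed u → Closed v → Before _⊏_ u v → Touch _⊏_ v w → u ⊏ w
  before-touch cu cv u◁v (inj₁ (_ , _ , spans p q r s)) = decidable-stable (_ ⊏? _) λ u⋢w →
    before-irrefl (subst (Before _⊏_ _)
      (bottom-unique (spans p q r s) (spans (above-anti cu cv u◁v p) q u⋢w s)) u◁v)
  before-touch cu cv u◁v (inj₂ (_ , _ , spans p q r s)) = decidable-stable (_ ⊏? _) λ u⋢w →
    before-irrefl (subst (Before _⊏_ _)
      (spanner-unique (spans p q r s) (spans p q (r ∘ below-mono cu cv u◁v) u⋢w)) u◁v)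

  -- If the touch has `u` as bottom, both spans have the same middle. If it has `u` as spanner and
  -- `x` as top, then `b` would be a second top unless `u` is below `b`.
  touch-spanned : ∀ {a b c x u} → Spans _⊏_ a b c x → Touch _⊏_ u x → u ⊏ b
  touch-spanned s (inj₁ (_ , _ , t@(spans p _ _ _)))
    with refl ← spanned-unique s t = p
  touch-spanned s@(spans a⊏b _ a⋢x _) (inj₂ (_ , _ , spans p q r t)) =
    decidable-stable (_ ⊏? _) λ u⋢b →
      a⋢x (subst (_ ⊏_) (top-unique (spans p (⊏-spanned s q) r u⋢b) (spans p q r t)) a⊏b)

  ⊏-spanner-or-touch : ∀ {a b c x u} → Spans _⊏_ a b c x → u ⊏ b → u ⊏ x ⊎ Touch _⊏_ u x
  ⊏-spanner-or-touch {x = x} {u} (spans _ q _ s) u⊏b with u ⊏? x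
  ... | yes u⊏x = inj₁ u⊏x
  ... | no  u⋢x = inj₂ (inj₁ (_ , _ , spans u⊏b q u⋢x s))

  spanner-⊏-or-touch : ∀ {a b c x u} → Spans _⊏_ a b c x → b ⊏ u → x ⊏ u ⊎ Touch _⊏_ x u
  spanner-⊏-or-touch {x = x} {u} (spans p _ r _) b⊏u with x ⊏? u
  ... | yes x⊏u = inj₁ x⊏u
  ... | no  x⋢u = inj₂ (inj₂ (_ , _ , spans p b⊏u r x⋢u))

  -- When `x` is not below `x′`, either `b` or `b′` is the middle of a span making them touch;
  -- failing both, `b` and `b′` are consecutive middles, against `unchained`.
  spanners-⊏-or-touch : ∀ {a b c x a′ b′ c′ x′} → Spans _⊏_ a b c x → Spans _⊏_ a′ b′ c′ x′ →
    b ⊏ b′ → x ⊏ x′ ⊎ Touch _⊏_ x x′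
  spanners-⊏-or-touch {b = b} {x = x} {b′ = b′} {x′ = x′} (spans p q r s) (spans p′ q′ r′ s′) b⊏b′
    with x ⊏? x′ | b ⊏? x′ | x ⊏? b′
  ... | yes x⊏x′ | _ | _ = inj₁ x⊏x′
  ... | no  x⋢x′ | yes b⊏x′ | _ = inj₂ (inj₂ (_ , _ , spans p b⊏x′ r x⋢x′))
  ... | no  x⋢x′ | no _ | yes x⊏b′ = inj₂ (inj₁ (_ , _ , spans x⊏b′ q′ x⋢x′ s′))
  ... | no  _ | no b⋢x′ | no x⋢b′ with () ← unchained (spans p b⊏b′ r x⋢b′) (spans b⊏b′ q′ b⋢x′ s′)

  -- Predecessors plus non-successors: both sets grow along `Before` on closed elements, and one of
  -- them strictly, so the order becomes a rank for induction.
  key : Fin n → ℕ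
  key v = count (λ z → z ⊏? v) ℕ.+ count (λ z → ¬? (v ⊏? z))

  key≤n+n : ∀ v → key v ℕ.≤ n ℕ.+ n
  key≤n+n v = ℕ.+-mono-≤ (count≤n (_⊏? v)) (count≤n (λ z → ¬? (v ⊏? z)))

  before⇒key< : ∀ {u v} → Closed u → Closed v → Before _⊏_ u v → key u ℕ.< key v
  before⇒key< {u} {v} cu cv u◁v with u◁v
  ... | inj₁ (_ , p , ¬p) = ℕ.+-mono-<-≤
    (count-strict (_⊏? u) (_⊏? v) (below-mono cu cv u◁v) p ¬p)
    (count-mono (λ z → ¬? (u ⊏? z)) (λ z → ¬? (v ⊏? z)) (_∘ above-anti cu cv u◁v))
  ... | inj₂ (_ , p , ¬p) = ℕ.+-mono-≤-<
    (count-mono (_⊏? u) (_⊏? v) (below-mono cu cv u◁v))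
    (count-strict (λ z → ¬? (u ⊏? z)) (λ z → ¬? (v ⊏? z)) (_∘ above-anti cu cv u◁v) ¬p λ ¬q → ¬q p)

module SpanDuality {n} {_⊏_ : Rel (Fin n) 0ℓ} (A : SpanAxioms _⊏_) where
  open SpanTheory A
  private module ᵒᵖ = SpanTheory (flip-axioms A)

  -- The mirror image of `before-touch`; reversing the order exchanges the two summands of `Before`.
  touch-before : ∀ {u v w} → Closed v → Closed w → Touch _⊏_ u v → Before _⊏_ v w → u ⊏ w
  touch-before cv cw u~v v◁w = ᵒᵖ.before-touch (cw ∘ flip-middle) (cv ∘ flip-middle)
    (Sum.swap v◁w) (flip-touch u~v)

  spanned-touch : ∀ {a b c x u} → Spans _⊏_ a b c x → Touch _⊏_ x u → b ⊏ u
  spanned-touch s x~u = ᵒᵖ.touch-spanned (flip-spans s) (flip-touch x~u)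

-- Greedy placement

p<p+1 : ∀ p → p < p + 1ℚ
p<p+1 p = subst (_< p + 1ℚ) (ℚ.+-identityʳ p) (ℚ.+-monoʳ-< p (ℚ.positive⁻¹ 1ℚ))

p-1<p : ∀ p → p - 1ℚ < p
p-1<p p = subst (p - 1ℚ <_) (ℚ.+-identityʳ p) (ℚ.+-monoʳ-< p (ℚ.negative⁻¹ (- 1ℚ)))

+1-mono : ∀ {p q} → p < q → p + 1ℚ < q + 1ℚ
+1-mono = ℚ.+-monoˡ-< 1ℚ

minorant : ∀ us → ∃[ q ] All (q <_) us
minorant [] = 0ℚ , []
minorant (u ∷ us) with minorant us
... | q , q<us with q <? u
...   | yes q<u = q , q<u ∷ q<us
...   | no  q≮u = u - 1ℚ , p-1<p u ∷ All.map (ℚ.<-trans (ℚ.<-≤-trans (p-1<p u) (ℚ.≮⇒≥ q≮u))) q<us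

squeeze : ∀ {p} us → All (p <_) us → ∃[ q ] (p < q × All (q <_) us)
squeeze {p} [] [] = p + 1ℚ , p<p+1 p , []
squeeze (u ∷ us) (p<u ∷ p<us) with squeeze us p<us
... | q , p<q , q<us with q <? u
...   | yes q<u = q , p<q , q<u ∷ q<us
...   | no  q≮u with r , p<r , r<u ← ℚ.<-dense p<u =
  r , p<r , r<u ∷ All.map (ℚ.<-trans (ℚ.<-≤-trans r<u (ℚ.≮⇒≥ q≮u))) q<us

-- The point found for the tail is kept if it exceeds `l`. Otherwise a point just above `l` still
-- exceeds the rest of `ls`, and `squeeze` keeps it below `us`.
separate : ∀ ls us → All (λ l → All (l <_) us) ls → ∃[ q ] (All (_< q) ls × All (q <_) us)
separate [] us [] with q , q<us ← minorant us = q , [] , q<us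
separate (l ∷ ls) us (l<us ∷ ls<us) with separate ls us ls<us
... | q , ls<q , q<us with l <? q
...   | yes l<q = q , l<q ∷ ls<q , q<us
...   | no  l≮q with r , l<r , r<us ← squeeze us l<us =
  r , l<r ∷ All.map (λ x<q → ℚ.<-trans x<q (ℚ.≤-<-trans (ℚ.≮⇒≥ l≮q) l<r)) ls<q , r<us

module _ {n} {L U : Pred (Fin n) 0ℓ} (L? : Unary.Decidable L) (U? : Unary.Decidable U) where

  separate-families : ∀ (f g : Fin n → ℚ) → (∀ {i j} → L i → U j → f i < g j) →
    ∃[ q ] ((∀ {i} → L i → f i < q) × (∀ {j} → U j → q < g j))
  separate-families f g f<g =
    let q , ls<q , q<us = separate ls us (All.tabulate λ l∈ → All.tabulate λ u∈ → below l∈ u∈)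
    in  q
      , (λ {i} li → All.lookup ls<q (∈-map⁺ f (∈-filter⁺ L? (∈-allFin i) li)))
      , (λ {j} uj → All.lookup q<us (∈-map⁺ g (∈-filter⁺ U? (∈-allFin j) uj)))
    where
    ls us : List ℚ
    ls = map f (filter L? (allFin n))
    us = map g (filter U? (allFin n))

    below : ∀ {l u} → l ∈ ls → u ∈ us → l < u
    below l∈ u∈ with ∈-map⁻ f l∈ | ∈-map⁻ g u∈
    ... | _ , i∈ , refl | _ , j∈ , refl =
      f<g (proj₂ (∈-filter⁻ L? {xs = allFin n} i∈)) (proj₂ (∈-filter⁻ U? {xs = allFin n} j∈))

module Placement {n} {_⊏_ : Rel (Fin n) 0ℓ} (A : SpanAxioms _⊏_)
  (connected : ∀ {u v} → u ≢ v → Before _⊏_ u v ⊎ Before _⊏_ v u) where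
  open SpanAxioms A
  open SpanTheory A
  open SpanDuality A

  private
    _◁_ = Before _⊏_
    _~_ = Touch _⊏_

  -- For closed unit intervals with left endpoints `p` and `q`, the last three fields are a gap, a
  -- common endpoint, and an overlap in more than a point.
  record Fits (u v : Fin n) (p q : ℚ) : Set where
    field
      below   : p < q
      apart   : u ⊏ v → p + 1ℚ < q
      touch   : u ~ v → p + 1ℚ ≡ q
      near  : ¬ u ⊏ v → ¬ u ~ v → q < p + 1ℚ

  open Fits

  module Extend (ℓ : Fin n → ℚ) {v} (cv : Closed v)
    (fits : ∀ {u w} → Closed u → Closed w → u ◁ w → w ◁ v → Fits u w (ℓ u) (ℓ w)) where

    ℓ-mono : ∀ {u w} → Closed u → Closed w → u ≡ w ⊎ u ◁ w → w ◁ v → ℓ u ≤ ℓ w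
    ℓ-mono cu cw (inj₁ refl) w◁v = ℚ.≤-refl
    ℓ-mono cu cw (inj₂ u◁w)  w◁v = ℚ.<⇒≤ (below (fits cu cw u◁w w◁v))

    compare : ∀ u w → (u ≡ w ⊎ u ◁ w) ⊎ w ◁ u
    compare u w with u ≟ w
    ... | yes u≡w = inj₁ (inj₁ u≡w)
    ... | no  u≢w = Sum.map₁ inj₂ (connected u≢w)

    module _ {u} (cu : Closed u) (u◁v : u ◁ v) (u⋢v : ¬ u ⊏ v) where

      -- For `w` after `u`, neither `u ⊏ w` nor a touch of `u` and `w` is possible, as each would
      -- force `u ⊏ v`; so `w` overlaps `u`.
      within-unit : ∀ {w} → Closed w → w ◁ v → ℓ w < ℓ u + 1ℚ
      within-unit {w} cw w◁v with compare w u
      ... | inj₁ w≤u = ℚ.≤-<-trans (ℓ-mono cw cu w≤u u◁v) (p<p+1 _)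
      ... | inj₂ u◁w = near (fits cu cw u◁w w◁v)
        (u⋢v ∘ below-mono cw cv w◁v) (λ u~w → u⋢v (touch-before cw cv u~w w◁v))

      -- Since `w` is below `v` and `u` is not, `w` must come before `u`.
      apart-below : ∀ {w} → Closed w → w ◁ v → w ⊏ v → ℓ w + 1ℚ < ℓ u + 1ℚ
      apart-below {w} cw w◁v w⊏v with compare u w
      ... | inj₁ (inj₁ refl) = contradiction w⊏v u⋢v
      ... | inj₁ (inj₂ u◁w) = contradiction (above-anti cu cw u◁w w⊏v) u⋢v
      ... | inj₂ w◁u = +1-mono (below (fits cw cu w◁u u◁v))

    -- A touching `u` dictates the position of `v`. By `before-touch` it is the only closed element
    -- touching `v`, and all closed elements before it are below `v`.
    extend-touching : ∀ {u} → Closed u → u ~ v → ∀ {w} → Closed w → w ◁ v → Fits w v (ℓ w) (ℓ u + 1ℚ)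
    extend-touching {u} cu u~v {w} cw w◁v = record
      { below   = within-unit cu u◁v u⋢v cw w◁v
      ; apart   = apart-below cu u◁v u⋢v cw w◁v
      ; touch   = λ w~v → cong (_+ 1ℚ) (touch-same w~v)
      ; near    = over
      }
      where
      u◁v = touch⇒before u~v
      u⋢v = touch⇒⋢ u~v

      touch-same : w ~ v → ℓ w ≡ ℓ u
      touch-same w~v with compare w u
      ... | inj₁ (inj₁ refl) = refl
      ... | inj₁ (inj₂ w◁u) = contradiction (before-touch cw cu w◁u u~v) (touch⇒⋢ w~v)
      ... | inj₂ u◁w = contradiction (before-touch cu cw u◁w w~v) u⋢v

      over : ¬ w ⊏ v → ¬ w ~ v → ℓ u + 1ℚ < ℓ w + 1ℚ
      over w⋢v w≁v with compare w u
      ... | inj₁ (inj₁ refl) = contradiction u~v w≁v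
      ... | inj₁ (inj₂ w◁u) = contradiction (before-touch cw cu w◁u u~v) w⋢v
      ... | inj₂ u◁w = +1-mono (below (fits cu cw u◁w w◁v))

    extend-free : (∀ {u} → Closed u → ¬ u ~ v) →
                  ∃[ q ] (∀ {w} → Closed w → w ◁ v → Fits w v (ℓ w) q)
    extend-free untouched =
      let q , lo<q , q<hi = separate-families
            (λ u → closed? u ×-dec before? ferrersOrder u v)
            (λ u → (closed? u ×-dec before? ferrersOrder u v) ×-dec ¬? (u ⊏? v))
            lower (λ u → ℓ u + 1ℚ)
            λ (cw , w◁v) ((cu , u◁v) , u⋢v) → lower<upper cu u◁v u⋢v cw w◁v
      in  q , λ {w} cw w◁v → record
            { below   = ℚ.≤-<-trans (ℓ≤lower w) (lo<q (cw , w◁v))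
            ; apart   = λ w⊏v → subst (_< q) (lower-apart w⊏v) (lo<q (cw , w◁v))
            ; touch   = λ w~v → contradiction w~v (untouched cw)
            ; near    = λ w⋢v _ → q<hi ((cw , w◁v) , w⋢v)
            }
      where
      -- The new point must exceed `ℓ u`, or the right end `ℓ u + 1ℚ` when `u` is below `v`. Its
      -- upper bounds are the right ends of the elements not below `v`.
      lower : Fin n → ℚ
      lower u with u ⊏? v
      ... | yes _ = ℓ u + 1ℚ
      ... | no  _ = ℓ u

      ℓ≤lower : ∀ u → ℓ u ≤ lower u
      ℓ≤lower u with u ⊏? v
      ... | yes _ = ℚ.<⇒≤ (p<p+1 (ℓ u))
      ... | no  _ = ℚ.≤-refl

      lower-apart : ∀ {u} → u ⊏ v → lower u ≡ ℓ u + 1ℚ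
      lower-apart {u} u⊏v with u ⊏? v
      ... | yes _   = refl
      ... | no  u⋢v = contradiction u⊏v u⋢v

      lower<upper : ∀ {u} → Closed u → u ◁ v → ¬ u ⊏ v →
                    ∀ {w} → Closed w → w ◁ v → lower w < ℓ u + 1ℚ
      lower<upper cu u◁v u⋢v {w} cw w◁v with w ⊏? v
      ... | yes w⊏v = apart-below cu u◁v u⋢v cw w◁v w⊏v
      ... | no  _   = within-unit cu u◁v u⋢v cw w◁v

    extend : ∃[ q ] (∀ {w} → Closed w → w ◁ v → Fits w v (ℓ w) q)
    extend with any? (λ u → closed? u ×-dec touch? u v)
    ... | yes (u , cu , u~v) = ℓ u + 1ℚ , extend-touching cu u~v
    ... | no  none           = extend-free λ cu u~v → none (_ , cu , u~v)

  key-unique : ∀ {u v} → Closed u → Closed v → key u ≡ key v → u ≡ v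
  key-unique {u} {v} cu cv eq with u ≟ v
  ... | yes u≡v = u≡v
  ... | no  u≢v with connected u≢v
  ...   | inj₁ u◁v = contradiction eq (ℕ.<⇒≢ (before⇒key< cu cv u◁v))
  ...   | inj₂ v◁u = contradiction (sym eq) (ℕ.<⇒≢ (before⇒key< cv cu v◁u))

  Placed : ℕ → (Fin n → ℚ) → Set
  Placed k ℓ = ∀ {u v} → Closed u → Closed v → u ◁ v → key v ℕ.< k → Fits u v (ℓ u) (ℓ v)

  module _ {ℓ m q} (cm : Closed m) (placed : Placed (key m) ℓ)
    (fits-m : ∀ {u} → Closed u → u ◁ m → Fits u m (ℓ u) q) where

    -- Moving `m` disturbs no earlier constraint: in the pairs considered, the smaller element has
    -- key below `key m`, so `m` can occur only as the larger one.
    placed-updateAt : Placed (suc (key m)) (updateAt ℓ m λ _ → q)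
    placed-updateAt {u} {v} cu cv u◁v kv≤km =
      subst (λ p → Fits u v p _) (sym (updateAt-minimal u m ℓ u≢m)) at-v
      where
      u≢m : u ≢ m
      u≢m refl = ℕ.<⇒≱ (before⇒key< cu cv u◁v) (ℕ.s≤s⁻¹ kv≤km)

      at-v : Fits u v (ℓ u) (updateAt ℓ m (λ _ → q) v)
      at-v with v ≟ m
      ... | yes refl = subst (Fits u v (ℓ u)) (sym (updateAt-updates m ℓ)) (fits-m cu u◁v)
      ... | no  v≢m  = subst (Fits u v (ℓ u)) (sym (updateAt-minimal v m ℓ v≢m))
        (placed cu cv u◁v (ℕ.≤∧≢⇒< (ℕ.s≤s⁻¹ kv≤km) (v≢m ∘ key-unique cv cm)))

  -- Stage `k` places the closed element of key `k`, of which there is at most one by `key-unique`,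
  -- and changes nothing if there is none.
  place-upto : ∀ k → ∃ (Placed k)
  place-upto zero = (λ _ → 0ℚ) , λ _ _ _ ()
  place-upto (suc k) with place-upto k | any? (λ v → closed? v ×-dec (key v ℕ.≟ k))
  ... | ℓ , placed | no none = ℓ , λ cu cv u◁v kv<1+k →
    placed cu cv u◁v (ℕ.≤∧≢⇒< (ℕ.s≤s⁻¹ kv<1+k) λ kv≡k → none (_ , cv , kv≡k))
  ... | ℓ , placed | yes (m , cm , refl)
    with q , fits-m ← Extend.extend ℓ cm (λ cu cw u◁w w◁m → placed cu cw u◁w (before⇒key< cw cm w◁m))
    = updateAt ℓ m (λ _ → q) , placed-updateAt cm placed fits-m

  placement : ∃[ ℓ ] (∀ {u v} → Closed u → Closed v → u ◁ v → Fits u v (ℓ u) (ℓ v))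
  -- The bound of `Placed` is strict and keys reach at most `n ℕ.+ n`, hence the successor.
  placement with ℓ , placed ← place-upto (suc (n ℕ.+ n)) =
    ℓ , λ {_} {v} cu cv u◁v → placed cu cv u◁v (ℕ.s≤s (key≤n+n v))

-- Intervals with open or closed ends

<⇒≱ : ∀ {p q} → p < q → ¬ q ≤ p
<⇒≱ p<q q≤p = ℚ.<-irrefl refl (ℚ.<-≤-trans p<q q≤p)

left≤right : ∀ I → left I ≤ right I
left≤right record { isOpen = true  ; nonempty = lt , _ } = ℚ.<⇒≤ (lt refl)
left≤right record { isOpen = false ; nonempty = _ , le } = le refl

∈⇒left≤ : ∀ I {p} → p ∈I I → left I ≤ p
∈⇒left≤ record { isOpen = true  } = ℚ.<⇒≤ ∘ proj₁
∈⇒left≤ record { isOpen = false } = proj₁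

∈⇒≤right : ∀ I {p} → p ∈I I → p ≤ right I
∈⇒≤right record { isOpen = true  } = ℚ.<⇒≤ ∘ proj₂
∈⇒≤right record { isOpen = false } = proj₂

open⇒left<right : ∀ I → isOpen I ≡ true → left I < right I
open⇒left<right I = proj₁ (nonempty I)

∈⇒left< : ∀ I {p} → isOpen I ≡ true → p ∈I I → left I < p
∈⇒left< record { isOpen = true } _ = proj₁

∈⇒<right : ∀ I {p} → isOpen I ≡ true → p ∈I I → p < right I
∈⇒<right record { isOpen = true } _ = proj₂

closed-∈ : ∀ I {p} → isOpen I ≡ false → left I ≤ p → p ≤ right I → p ∈I I
closed-∈ record { isOpen = false } _ = _,_

open-∈ : ∀ I {p} → left I < p → p < right I → p ∈I I
open-∈ record { isOpen = true  } l r = l , r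
open-∈ record { isOpen = false } l r = ℚ.<⇒≤ l , ℚ.<⇒≤ r

-- An open interval lacks its endpoints, so density supplies a member close to the left end; this
-- lets membership control endpoints.
point-left-of : ∀ I {m} → left I < m → ∃[ p ] (p ∈I I × p < m)
point-left-of I@record { isOpen = false } l<m = left I , (ℚ.≤-refl , left≤right I) , l<m
point-left-of I@record { isOpen = true } {m} l<m with m ≤? right I
... | yes m≤r with p , l<p , p<m ← ℚ.<-dense l<m = p , (l<p , ℚ.<-≤-trans p<m m≤r) , p<m
... | no  m≰r with p , l<p , p<r ← ℚ.<-dense (open⇒left<right I refl) =
  p , (l<p , p<r) , ℚ.<-trans p<r (ℚ.≰⇒> m≰r)

point-right-of : ∀ I {m} → m < right I → ∃[ p ] (p ∈I I × m < p)
point-right-of I@record { isOpen = false } m<r = right I , (left≤right I , ℚ.≤-refl) , m<r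
point-right-of I@record { isOpen = true } {m} m<r with left I ≤? m
... | yes l≤m with p , m<p , p<r ← ℚ.<-dense m<r = p , (ℚ.≤-<-trans l≤m m<p , p<r) , m<p
... | no  l≰m with p , l<p , p<r ← ℚ.<-dense (open⇒left<right I refl) =
  p , (l<p , p<r) , ℚ.<-trans (ℚ.≰⇒> l≰m) l<p

⊆⇒left≥ : ∀ I J → I ⊆I J → left J ≤ left I
⊆⇒left≥ I J I⊆J = ℚ.≮⇒≥ λ lI<lJ →
  let p , p∈I , p<lJ = point-left-of I lI<lJ in <⇒≱ p<lJ (∈⇒left≤ J (I⊆J p p∈I))

⊆⇒right≤ : ∀ I J → I ⊆I J → right I ≤ right J
⊆⇒right≤ I J I⊆J = ℚ.≮⇒≥ λ rJ<rI →
  let p , p∈I , rJ<p = point-right-of I rJ<rI in <⇒≱ rJ<p (∈⇒≤right J (I⊆J p p∈I))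

⊆⇒endpoints≡ : ∀ {I J} → ¬ StrictlyContained I J → I ⊆I J → left I ≡ left J × right I ≡ right J
⊆⇒endpoints≡ {I} {J} I⊄J I⊆J with (left I ℚ.≟ left J) ×-dec (right I ℚ.≟ right J)
... | yes eq = eq
... | no neq = contradiction (I⊆J , neq) I⊄J

-- The endpoint form of `≪`: a shared endpoint does no harm as soon as one of the intervals omits
-- it.
Clear : OCInterval → OCInterval → Set
Clear I J = right I ≤ left J × (right I ≡ left J → isOpen I ≡ true ⊎ isOpen J ≡ true)

clear⇒≪ : ∀ I J → Clear I J → I ≪ J
clear⇒≪ I J (r≤l , open-if-≡) p q p∈I q∈J with right I ℚ.≟ left J
... | no  r≢l = ℚ.≤-<-trans (∈⇒≤right I p∈I) (ℚ.<-≤-trans r<l (∈⇒left≤ J q∈J))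
  where r<l = ℚ.≰⇒> λ l≤r → r≢l (ℚ.≤-antisym r≤l l≤r)
... | yes r≡l with open-if-≡ r≡l
...   | inj₁ I-open = ℚ.<-≤-trans (∈⇒<right I I-open p∈I) (ℚ.≤-trans r≤l (∈⇒left≤ J q∈J))
...   | inj₂ J-open = ℚ.≤-<-trans (∈⇒≤right I p∈I) (ℚ.≤-<-trans r≤l (∈⇒left< J J-open q∈J))

≪⇒clear : ∀ I J → I ≪ J → Clear I J
≪⇒clear I J I≪J = ℚ.≮⇒≥ no-overlap , open-if-≡
  where
  no-overlap : ¬ left J < right I
  no-overlap l<r =
    let m , l<m , m<r = ℚ.<-dense l<r
        p , p∈I , m<p = point-right-of I m<r
        q , q∈J , q<m = point-left-of J l<m
    in  ℚ.<-asym (I≪J p q p∈I q∈J) (ℚ.<-trans q<m m<p)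

  open-if-≡ : right I ≡ left J → isOpen I ≡ true ⊎ isOpen J ≡ true
  open-if-≡ r≡l with isOpen I Bool.≟ true | isOpen J Bool.≟ true
  ... | yes oI | _      = inj₁ oI
  ... | no  _  | yes oJ = inj₂ oJ
  ... | no ¬oI | no ¬oJ = contradiction r≡l (ℚ.<⇒≢ (I≪J _ _
    (closed-∈ I (¬-not ¬oI) (left≤right I) ℚ.≤-refl)
    (closed-∈ J (¬-not ¬oJ) ℚ.≤-refl (left≤right J))))

≪̸⇒meet : ∀ I J → ¬ I ≪ J →
  left J ≤ right I × (left J ≡ right I → isOpen I ≡ false × isOpen J ≡ false)
≪̸⇒meet I J I≪̸J =
    ℚ.≮⇒≥ (λ r<l → I≪̸J (clear⇒≪ I J (ℚ.<⇒≤ r<l , λ r≡l → contradiction r≡l (ℚ.<⇒≢ r<l))))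
  , λ l≡r → let r≤l = ℚ.≤-reflexive (sym l≡r) in
      ¬-not (λ oI → I≪̸J (clear⇒≪ I J (r≤l , λ _ → inj₁ oI)))
    , ¬-not (λ oJ → I≪̸J (clear⇒≪ I J (r≤l , λ _ → inj₂ oJ)))

record SameShape (I J : OCInterval) : Set where
  constructor same-shape
  field
    left≡   : left I ≡ left J
    right≡  : right I ≡ right J
    isOpen≡ : isOpen I ≡ isOpen J

same-shape-sym : ∀ {I J} → SameShape I J → SameShape J I
same-shape-sym (same-shape l r o) = same-shape (sym l) (sym r) (sym o)

same-shape-⊆ : ∀ {I J} → SameShape I J → I ⊆I J
same-shape-⊆ {record { isOpen = true  }} {record { isOpen = true  }} (same-shape refl refl refl) p p∈ = p∈
same-shape-⊆ {record { isOpen = false }} {record { isOpen = false }} (same-shape refl refl refl) p p∈ = p∈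

record Pinned (a b c x : OCInterval) : Set where
  field
    a-right  : right a ≡ left x
    b-left   : left b ≡ left x
    b-right  : right b ≡ right x
    c-left   : left c ≡ right x
    a-closed : isOpen a ≡ false
    b-open   : isOpen b ≡ true
    c-closed : isOpen c ≡ false
    x-closed : isOpen x ≡ false

-- The interval x reaches over b on both sides, so it contains b unless the two
-- have the same endpoints; the end types are then forced.
pinned : ∀ {a b c x} → ¬ StrictlyContained b x → a ≪ b → b ≪ c → ¬ a ≪ x → ¬ x ≪ c → Pinned a b c x
pinned {a} {b} {c} {x} b⊄x a≪b b≪c a≪̸x x≪̸c = record
  { a-right = ra≡lx ; b-left = lb≡lx ; b-right = rb≡rx ; c-left = lc≡rx
  ; a-closed = proj₁ a,x-closed ; b-open = b-open
  ; c-closed = proj₂ x,c-closed ; x-closed = x-closed }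
  where
  ra≤lb = proj₁ (≪⇒clear a b a≪b)
  rb≤lc = proj₁ (≪⇒clear b c b≪c)
  lx≤ra = proj₁ (≪̸⇒meet a x a≪̸x)
  lc≤rx = proj₁ (≪̸⇒meet x c x≪̸c)
  lx≤lb = ℚ.≤-trans lx≤ra ra≤lb
  rb≤rx = ℚ.≤-trans rb≤lc lc≤rx

  b⊆x : b ⊆I x
  b⊆x p p∈b with isOpen x Bool.≟ true
  ... | no  x-closed = closed-∈ x (¬-not x-closed)
    (ℚ.≤-trans lx≤lb (∈⇒left≤ b p∈b)) (ℚ.≤-trans (∈⇒≤right b p∈b) rb≤rx)
  -- An open `x` cannot meet `a` or `c` in a mere endpoint, so its ends lie strictly beyond those of
  -- `b`.
  ... | yes x-open = open-∈ x
    (ℚ.<-≤-trans (ℚ.≰⇒> λ ra≤lx → not-¬ x-open (proj₂ (proj₂ (≪̸⇒meet a x a≪̸x) (ℚ.≤-antisym lx≤ra ra≤lx))))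
      (ℚ.≤-trans ra≤lb (∈⇒left≤ b p∈b)))
    (ℚ.≤-<-trans (ℚ.≤-trans (∈⇒≤right b p∈b) rb≤lc)
      (ℚ.≰⇒> λ rx≤lc → not-¬ x-open (proj₁ (proj₂ (≪̸⇒meet x c x≪̸c) (ℚ.≤-antisym lc≤rx rx≤lc)))))

  endpoints : left b ≡ left x × right b ≡ right x
  endpoints = ⊆⇒endpoints≡ b⊄x b⊆x

  lb≡lx = proj₁ endpoints
  rb≡rx = proj₂ endpoints
  ra≡lx = ℚ.≤-antisym (ℚ.≤-trans ra≤lb (ℚ.≤-reflexive lb≡lx)) lx≤ra
  lc≡rx = ℚ.≤-antisym lc≤rx (ℚ.≤-trans (ℚ.≤-reflexive (sym rb≡rx)) rb≤lc)
  a,x-closed = proj₂ (≪̸⇒meet a x a≪̸x) (sym ra≡lx)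
  x,c-closed = proj₂ (≪̸⇒meet x c x≪̸c) lc≡rx
  x-closed = proj₁ x,c-closed

  b-open : isOpen b ≡ true
  b-open with proj₂ (≪⇒clear a b a≪b) (≡-trans ra≡lx (sym lb≡lx))
  ... | inj₁ a-open = contradiction (proj₁ a,x-closed) (not-¬ a-open)
  ... | inj₂ b-open = b-open

-- Containment orders both pairs of endpoints, and a strict inequality in either would make the
-- lengths differ.
⊆-length≡⇒endpoints≡ : ∀ {I J} → length I ≡ length J → I ⊆I J → left I ≡ left J × right I ≡ right J
⊆-length≡⇒endpoints≡ {I} {J} |I|≡|J| I⊆J =
    ℚ.≤-antisym (ℚ.≮⇒≥ λ lJ<lI → ℚ.<⇒≢ (ℚ.+-mono-≤-< rI≤rJ (ℚ.neg-antimono-< lJ<lI)) |I|≡|J|) lJ≤lI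
  , ℚ.≤-antisym rI≤rJ (ℚ.≮⇒≥ λ rI<rJ → ℚ.<⇒≢ (ℚ.+-mono-<-≤ rI<rJ (ℚ.neg-antimono-≤ lJ≤lI)) |I|≡|J|)
  where
  lJ≤lI = ⊆⇒left≥ I J I⊆J
  rI≤rJ = ⊆⇒right≤ I J I⊆J

-- From unit to strict representations, and from these to the span axioms.

unit⇒strict : ∀ P → IsUnitOCIntervalOrder P → IsStrictOCIntervalOrder P
unit⇒strict P (I , rep , ℓ , |I|≡ℓ) =
  I , rep , λ u v (Iu⊆Iv , neq) → neq (⊆-length≡⇒endpoints≡ (≡-trans (|I|≡ℓ u) (sym (|I|≡ℓ v))) Iu⊆Iv)

interval⇒ferrers : ∀ P → IsIntervalOrder P → FerrersOrder (_≺_ P)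
interval⇒ferrers P (L , R , L≤R , rep) = record
  { _⊏?_     = λ x y → map′ (from (rep x y)) (to (rep x y)) (R x <? L y)
  ; ⊏-irrefl = FinPoset.irrefl P _
  ; ⊏-trans  = FinPoset.trans P
  ; ferrers  = ferrers
  }
  where
  ferrers : ∀ {u v w z} → _≺_ P u v → _≺_ P w z → _≺_ P u z ⊎ _≺_ P w v
  ferrers {u} {v} {w} {z} u≺v w≺z with R u <? L z
  ... | yes Ru<Lz = inj₁ (from (rep u z) Ru<Lz)
  ... | no  Ru≮Lz = inj₂ (from (rep w v)
    (ℚ.<-trans (to (rep w z) w≺z) (ℚ.≤-<-trans (ℚ.≮⇒≥ Ru≮Lz) (to (rep u v) u≺v))))

module _ (P : FinPoset) (ferrersOrder : FerrersOrder (_≺_ P)) (twin-free : TwinFree P)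
         (I : Elt P → OCInterval) (rep : IsOCRepresentation P I)
         (strict : ∀ u v → ¬ StrictlyContained (I u) (I v)) where

  private
    ≪-respˡ : ∀ {x y z} → SameShape (I x) (I y) → _≺_ P x z → _≺_ P y z
    ≪-respˡ {x} {y} {z} same x≺z =
      from (rep y z) λ p q p∈ → to (rep x z) x≺z p q (same-shape-⊆ (same-shape-sym same) p p∈)

    ≪-respʳ : ∀ {x y z} → SameShape (I x) (I y) → _≺_ P z x → _≺_ P z y
    ≪-respʳ {x} {y} {z} same z≺x =
      from (rep z y) λ p q p∈ q∈ → to (rep z x) z≺x p q p∈ (same-shape-⊆ (same-shape-sym same) q q∈)

    -- Elements with the same interval have the same comparabilities, so distinct ones would be
    -- twins.
    same-shape⇒≡ : ∀ {x y} → SameShape (I x) (I y) → x ≡ y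
    same-shape⇒≡ {x} {y} same = decidable-stable (x ≟ y) λ x≢y → twin-free x y
      (x≢y , λ z → mk⇔ (≪-respʳ same) (≪-respʳ (same-shape-sym same))
                 , mk⇔ (≪-respˡ same) (≪-respˡ (same-shape-sym same)))

    nested-closed⇒≡ : ∀ {x y} → isOpen (I x) ≡ false → isOpen (I y) ≡ false →
      left (I y) ≤ left (I x) → right (I x) ≤ right (I y) → x ≡ y
    nested-closed⇒≡ {x} {y} ox oy ly≤lx rx≤ry
      with l , r ← ⊆⇒endpoints≡ (strict x y) (λ p p∈x → closed-∈ (I y) oy
                     (ℚ.≤-trans ly≤lx (∈⇒left≤ (I x) p∈x)) (ℚ.≤-trans (∈⇒≤right (I x) p∈x) rx≤ry))
      = same-shape⇒≡ (same-shape l r (≡-trans ox (sym oy)))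

    pin : ∀ {a b c x} → Spans (_≺_ P) a b c x → Pinned (I a) (I b) (I c) (I x)
    pin {a} {b} {c} {x} (spans p q r s) = pinned (strict b x)
      (to (rep a b) p) (to (rep b c) q) (r ∘ from (rep a x)) (s ∘ from (rep x c))

    open Pinned

  -- In two chained spans, `c` would be closed as a top and open as a middle. Spanners and middles
  -- are pinned completely; tops and bottoms only at one end, but closed intervals sharing an end
  -- are nested, which strictness forbids unless they agree.
  strict⇒span-axioms : SpanAxioms (_≺_ P)
  strict⇒span-axioms = record
    { ferrersOrder   = ferrersOrder
    ; unchained      = λ s t → not-¬ (b-open (pin t)) (c-closed (pin s))
    ; spanner-unique = λ s t → same-shape⇒≡ (same-shape
        (≡-trans (sym (b-left (pin s))) (b-left (pin t)))
        (≡-trans (sym (b-right (pin s))) (b-right (pin t)))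
        (≡-trans (x-closed (pin s)) (sym (x-closed (pin t)))))
    ; middle-unique  = λ s t → same-shape⇒≡ (same-shape
        (≡-trans (b-left (pin s)) (sym (b-left (pin t))))
        (≡-trans (b-right (pin s)) (sym (b-right (pin t))))
        (≡-trans (b-open (pin s)) (sym (b-open (pin t)))))
    ; top-unique     = λ s t → same-left (c-closed (pin s)) (c-closed (pin t))
        (≡-trans (c-left (pin s)) (sym (c-left (pin t))))
    ; bottom-unique  = λ s t → same-right (a-closed (pin s)) (a-closed (pin t))
        (≡-trans (a-right (pin s)) (sym (a-right (pin t))))
    }
    where
    same-left : ∀ {x y} → isOpen (I x) ≡ false → isOpen (I y) ≡ false → left (I x) ≡ left (I y) → x ≡ y
    same-left {x} {y} ox oy l with ℚ.≤-total (right (I x)) (right (I y))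
    ... | inj₁ rx≤ry = nested-closed⇒≡ ox oy (ℚ.≤-reflexive (sym l)) rx≤ry
    ... | inj₂ ry≤rx = sym (nested-closed⇒≡ oy ox (ℚ.≤-reflexive l) ry≤rx)

    same-right : ∀ {x y} → isOpen (I x) ≡ false → isOpen (I y) ≡ false → right (I x) ≡ right (I y) → x ≡ y
    same-right {x} {y} ox oy r with ℚ.≤-total (left (I x)) (left (I y))
    ... | inj₁ lx≤ly = sym (nested-closed⇒≡ oy ox lx≤ly (ℚ.≤-reflexive (sym r)))
    ... | inj₂ ly≤lx = nested-closed⇒≡ ox oy ly≤lx (ℚ.≤-reflexive r)

-- The unit representation read off from the placement.

twin-free⇒connected : ∀ P → FerrersOrder (_≺_ P) → TwinFree P →
  ∀ {u v} → u ≢ v → Before (_≺_ P) u v ⊎ Before (_≺_ P) v u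
twin-free⇒connected P F twin-free {u} {v} u≢v with before? F u v | before? F v u
... | yes u◁v | _       = inj₁ u◁v
... | no  _   | yes v◁u = inj₂ v◁u
... | no ¬u◁v | no ¬v◁u = contradiction (u≢v , λ z → mk⇔ (below ¬v◁u) (below ¬u◁v) , mk⇔ (above ¬u◁v) (above ¬v◁u))
                            (twin-free u v)
  where
  open FerrersOrder F

  below : ∀ {x y z} → ¬ Before (_≺_ P) y x → _≺_ P z x → _≺_ P z y
  below ¬y◁x z≺x = decidable-stable (_ ⊏? _) λ z⊀y → ¬y◁x (inj₁ (_ , z≺x , z⊀y))

  above : ∀ {x y z} → ¬ Before (_≺_ P) x y → _≺_ P x z → _≺_ P y z
  above ¬x◁y x≺z = decidable-stable (_ ⊏? _) λ y⊀z → ¬x◁y (inj₂ (_ , x≺z , y⊀z))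

unitInterval : ℚ → Bool → OCInterval
unitInterval p o = record
  { left = p ; right = p + 1ℚ ; isOpen = o
  ; nonempty = (λ _ → p<p+1 p) , (λ _ → ℚ.<⇒≤ (p<p+1 p)) }

length-unitInterval : ∀ p o → length (unitInterval p o) ≡ 1ℚ
length-unitInterval p o = begin
  (p + 1ℚ) - p   ≡⟨ cong (_- p) (ℚ.+-comm p 1ℚ) ⟩
  (1ℚ + p) - p   ≡⟨ ℚ.+-assoc 1ℚ p (- p) ⟩
  1ℚ + (p - p)   ≡⟨ cong (1ℚ +_) (ℚ.+-inverseʳ p) ⟩
  1ℚ + 0ℚ        ≡⟨ ℚ.+-identityʳ 1ℚ ⟩
  1ℚ             ∎
  where open ≡-Reasoning

module _ (P : FinPoset) (A : SpanAxioms (_≺_ P))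
  (connected : ∀ {u v} → u ≢ v → Before (_≺_ P) u v ⊎ Before (_≺_ P) v u) where

  open SpanAxioms A
  open SpanTheory A
  open SpanDuality A
  open Placement A connected

  private
    _~_ : Elt P → Elt P → Set
    _~_ = Touch (_≺_ P)

    _⋖_ : Elt P → Elt P → Set
    _⋖_ = _≺_ P

    ℓ : Elt P → ℚ
    ℓ = proj₁ placement

    fits : ∀ {u v} → Closed u → Closed v → Before (_≺_ P) u v → Fits u v (ℓ u) (ℓ v)
    fits = proj₂ placement

    open Fits

    I : Elt P → OCInterval
    I v with middle? v
    ... | yes (_ , _ , x , _) = unitInterval (ℓ x) true
    ... | no _ = unitInterval (ℓ v) false

    -- With `reach⁻`, the weak comparison of ends amounts to being below or touching. Only the open
    -- ends of middles then tell these two cases apart.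
    reach⁺ : ∀ {u v} → Closed u → Closed v → u ⋖ v ⊎ u ~ v → ℓ u + 1ℚ ≤ ℓ v
    reach⁺ cu cv (inj₁ u⋖v) = ℚ.<⇒≤ (apart (fits cu cv (⊏⇒before u⋖v)) u⋖v)
    reach⁺ cu cv (inj₂ u~v) = ℚ.≤-reflexive (touch (fits cu cv (touch⇒before u~v)) u~v)

    reach⁻ : ∀ {u v} → Closed u → Closed v → ℓ u + 1ℚ ≤ ℓ v → u ⋖ v ⊎ u ~ v
    reach⁻ {u} {v} cu cv reach with u ⊏? v | touch? u v
    ... | yes u⋖v | _       = inj₁ u⋖v
    ... | no  _   | yes u~v = inj₂ u~v
    ... | no u⋪v  | no u≁v  = contradiction reach (<⇒≱ ℓv<ℓu+1)
      where
      ℓv<ℓu+1 : ℓ v < ℓ u + 1ℚ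
      ℓv<ℓu+1 with u ≟ v
      ... | yes refl = p<p+1 _
      ... | no  u≢v with connected u≢v
      ...   | inj₁ u◁v = near (fits cu cv u◁v) u⋪v u≁v
      ...   | inj₂ v◁u = ℚ.<-trans (below (fits cv cu v◁u)) (p<p+1 _)

    -- A touch counts as precedence exactly when an open interval is involved. Each middle is traded
    -- for its spanner, and the span lemmas translate being below or touching the spanner into being
    -- below the middle, and dually.
    represents-clear : ∀ u v → u ⋖ v ⇔ Clear (I u) (I v)
    represents-clear u v with middle? u | middle? v
    ... | no cu | no cv = mk⇔
      (λ u⋖v → let gap = apart (fits cu cv (⊏⇒before u⋖v)) u⋖v in
        ℚ.<⇒≤ gap , λ eq → contradiction eq (ℚ.<⇒≢ gap))
      λ (reach , open-if-≡) → case reach⁻ cu cv reach of λ where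
        (inj₁ u⋖v) → u⋖v
        (inj₂ u~v) → case open-if-≡ (touch (fits cu cv (touch⇒before u~v)) u~v) of λ where
          (inj₁ ())
          (inj₂ ())
    ... | no cu | yes (_ , _ , x , s) = mk⇔
      (λ u⋖v → reach⁺ cu (spanner-closed s) (⊏-spanner-or-touch s u⋖v) , λ _ → inj₂ refl)
      (Sum.[ ⊏-spanned s , touch-spanned s ] ∘ reach⁻ cu (spanner-closed s) ∘ proj₁)
    ... | yes (_ , _ , x , s) | no cv = mk⇔
      (λ u⋖v → reach⁺ (spanner-closed s) cv (spanner-⊏-or-touch s u⋖v) , λ _ → inj₁ refl)
      (Sum.[ spanned-⊏ s , spanned-touch s ] ∘ reach⁻ (spanner-closed s) cv ∘ proj₁)
    ... | yes (_ , _ , x , s) | yes (_ , _ , y , t) = mk⇔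
      (λ u⋖v → reach⁺ (spanner-closed s) (spanner-closed t) (spanners-⊏-or-touch s t u⋖v) , λ _ → inj₁ refl)
      (Sum.[ ⊏-spanned t ∘ spanned-⊏ s , spanned-⊏ s ∘ touch-spanned t ]
        ∘ reach⁻ (spanner-closed s) (spanner-closed t) ∘ proj₁)

    length-I : ∀ v → length (I v) ≡ 1ℚ
    length-I v with middle? v
    ... | yes (_ , _ , x , _) = length-unitInterval (ℓ x) true
    ... | no _ = length-unitInterval (ℓ v) false

  span-axioms⇒unit : IsUnitOCIntervalOrder P
  span-axioms⇒unit = I
    , (λ u v → mk⇔ (clear⇒≪ (I u) (I v) ∘ to (represents-clear u v))
                   (from (represents-clear u v) ∘ ≪⇒clear (I u) (I v)))
    , 1ℚ , length-I

-- Induced forbidden posets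

module _ {A : Set} {R : Rel A 0ℓ} where

  allPairs-lookup : Symmetric R → ∀ {xs} → AllPairs R xs →
                    ∀ {x y} → x ∈ xs → y ∈ xs → x ≡ y ⊎ R x y
  allPairs-lookup symR (Rx ∷ _)  (here refl) (here refl) = inj₁ refl
  allPairs-lookup symR (Rx ∷ _)  (here refl) (there y∈)  = inj₂ (All.lookup Rx y∈)
  allPairs-lookup symR (Rx ∷ _)  (there x∈)  (here refl) = inj₂ (symR (All.lookup Rx x∈))
  allPairs-lookup symR (_  ∷ Rs) (there x∈)  (there y∈)  = allPairs-lookup symR Rs x∈ y∈

module Induced (P : FinPoset) (F : FerrersOrder (_≺_ P)) where
  open FerrersOrder F

  private
    _⋖_ : Elt P → Elt P → Set
    _⋖_ = _≺_ P

  Incomparable : Elt P → Elt P → Set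
  Incomparable x y = x ≢ y × ¬ x ⋖ y × ¬ y ⋖ x

  module _ {m} (G : Fin m → Fin m → Set) (f : Fin m → Elt P) where

    Settled : Fin m → Fin m → Set
    Settled i j = TC G i j ⊎ TC G j i ⊎ Incomparable (f i) (f j)

    settled-sym : Symmetric Settled
    settled-sym (inj₁ ij) = inj₂ (inj₁ ij)
    settled-sym (inj₂ (inj₁ ji)) = inj₁ ji
    settled-sym (inj₂ (inj₂ (ne , nl , ng))) = inj₂ (inj₂ (ne ∘ sym , ng , nl))

    -- Edges propagate along paths. A coincidence or an extra relation would close a cycle or
    -- contradict an incomparability, so checking each unordered pair once suffices.
    induced : (∀ {i j} → G i j → f i ⋖ f j) → AllPairs Settled (allFin m) → HasInduced P (TC G)
    induced hom settled = f , inj , λ i j → mk⇔ hom⁺ (hom⁻ i j)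
      where
      hom⁺ : ∀ {i j} → TC G i j → f i ⋖ f j
      hom⁺ (gen g)    = hom g
      hom⁺ (step s t) = ⊏-trans (hom⁺ s) (hom⁺ t)

      settle : ∀ i j → i ≡ j ⊎ Settled i j
      settle i j = allPairs-lookup settled-sym settled (∈-allFin i) (∈-allFin j)

      inj : ∀ i j → f i ≡ f j → i ≡ j
      inj i j fi≡fj with settle i j
      ... | inj₁ i≡j = i≡j
      ... | inj₂ (inj₁ ij) = contradiction (subst (_⋖ f j) fi≡fj (hom⁺ ij)) ⊏-irrefl
      ... | inj₂ (inj₂ (inj₁ ji)) = contradiction (subst (f j ⋖_) fi≡fj (hom⁺ ji)) ⊏-irrefl
      ... | inj₂ (inj₂ (inj₂ (fi≢fj , _))) = contradiction fi≡fj fi≢fj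

      hom⁻ : ∀ i j → f i ⋖ f j → TC G i j
      hom⁻ i j fi⋖fj with settle i j
      ... | inj₁ refl = contradiction fi⋖fj ⊏-irrefl
      ... | inj₂ (inj₁ ij) = ij
      ... | inj₂ (inj₂ (inj₁ ji)) = contradiction (⊏-trans fi⋖fj (hom⁺ ji)) ⊏-irrefl
      ... | inj₂ (inj₂ (inj₂ (_ , fi⋪fj , _))) = contradiction fi⋖fj fi⋪fj

  pattern above  t = inj₁ t
  pattern below  t = inj₂ (inj₁ t)
  pattern beside p = inj₂ (inj₂ p)

  module _ {a b c x} (s : Spans _⋖_ a b c x) where
    open Spans s

    a∥x : Incomparable a x
    a∥x = (λ { refl → x⋢c (⊏-trans a⊏b b⊏c) }) , a⋢x , λ x⊏a → x⋢c (⊏-trans x⊏a (⊏-trans a⊏b b⊏c))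

    b∥x : Incomparable b x
    b∥x = (λ { refl → a⋢x a⊏b }) , (λ b⊏x → a⋢x (⊏-trans a⊏b b⊏x)) , λ x⊏b → x⋢c (⊏-trans x⊏b b⊏c)

    c∥x : Incomparable c x
    c∥x = (λ { refl → a⋢x (⊏-trans a⊏b b⊏c) }) , (λ c⊏x → a⋢x (⊏-trans (⊏-trans a⊏b b⊏c) c⊏x)) , x⋢c

  induced-4+1 : ∀ {a b c d x} → Spans _⋖_ a b d x → b ⋖ c → c ⋖ d → HasInduced P Four+One
  induced-4+1 {a} {b} {c} {d} {x} s@(spans a⊏b _ a⋢x x⋢d) b⊏c c⊏d = induced G-4+1 (lookup (a ∷ b ∷ c ∷ d ∷ x ∷ []))
    (λ { ab → a⊏b ; bc → b⊏c ; cd → c⊏d })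
    ( (above (gen ab) ∷ above (step (gen ab) (gen bc)) ∷ above (step (gen ab) (step (gen bc) (gen cd))) ∷ beside (a∥x s) ∷ [])
    ∷ (above (gen bc) ∷ above (step (gen bc) (gen cd)) ∷ beside (b∥x s) ∷ [])
    ∷ (above (gen cd) ∷ beside (b∥x (spans (⊏-trans a⊏b b⊏c) c⊏d a⋢x x⋢d)) ∷ [])
    ∷ (beside (c∥x s) ∷ [])
    ∷ []
    ∷ [])

  induced-3+1+1 : ∀ {a b c x y} → Spans _⋖_ a b c x → Spans _⋖_ a b c y → x ≢ y → HasInduced P ThreeOneOne
  induced-3+1+1 {a} {b} {c} {x} {y} s t x≢y = induced G-3+1+1 (lookup (a ∷ b ∷ c ∷ x ∷ y ∷ []))
    (λ { ab → Spans.a⊏b s ; bc → Spans.b⊏c s })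
    ( (above (gen ab) ∷ above (step (gen ab) (gen bc)) ∷ beside (a∥x s) ∷ beside (a∥x t) ∷ [])
    ∷ (above (gen bc) ∷ beside (b∥x s) ∷ beside (b∥x t) ∷ [])
    ∷ (beside (c∥x s) ∷ beside (c∥x t) ∷ [])
    ∷ (beside (x≢y , x⋢y s t , x⋢y t s) ∷ [])
    ∷ []
    ∷ [])
    where
    -- Two spanners of one chain both overlap `b`, hence each other; `ferrers` against `a ⋖ b`
    -- expresses this.
    x⋢y : ∀ {x y} → Spans _⋖_ a b c x → Spans _⋖_ a b c y → ¬ x ⋖ y
    x⋢y (spans a⊏b b⊏c _ x⋢c) (spans _ _ a⋢y _) x⊏y with ferrers x⊏y a⊏b
    ... | inj₁ x⊏b = x⋢c (⊏-trans x⊏b b⊏c)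
    ... | inj₂ a⊏y = a⋢y a⊏y

  induced-Z : ∀ {a b c d x y} → Spans _⋖_ a b c x → Spans _⋖_ b c d y → x ⋖ d → a ⋖ y → HasInduced P PosetZ
  induced-Z {a} {b} {c} {d} {x} {y} s t x⊏d a⊏y = induced G-Z (lookup (a ∷ b ∷ c ∷ d ∷ x ∷ y ∷ []))
    (λ { ab → Spans.a⊏b s ; bc → Spans.b⊏c s ; cd → Spans.b⊏c t ; xd → x⊏d ; ay → a⊏y })
    ( (above (gen ab) ∷ above (step (gen ab) (gen bc)) ∷ above (step (gen ab) (step (gen bc) (gen cd)))
        ∷ beside (a∥x s) ∷ above (gen ay) ∷ [])
    ∷ (above (gen bc) ∷ above (step (gen bc) (gen cd)) ∷ beside (b∥x s) ∷ beside (a∥x t) ∷ [])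
    ∷ (above (gen cd) ∷ beside (c∥x s) ∷ beside (b∥x t) ∷ [])
    ∷ (below (gen xd) ∷ beside (c∥x t) ∷ [])
    ∷ (beside (x≢y , x⋢y , y⋢x) ∷ [])
    ∷ []
    ∷ [])
    where
    y⋢d = Spans.x⋢c t

    x≢y : x ≢ y
    x≢y refl = y⋢d x⊏d

    x⋢y : ¬ x ⋖ y
    x⋢y x⊏y with ferrers x⊏y (Spans.b⊏c s)
    ... | inj₁ x⊏c = Spans.x⋢c s x⊏c
    ... | inj₂ b⊏y = Spans.a⋢x t b⊏y

    y⋢x : ¬ y ⋖ x
    y⋢x y⊏x = y⋢d (⊏-trans y⊏x x⊏d)

  induced-D : ∀ {a b c d x} → Spans _⋖_ a b d x → Spans _⋖_ a c d x → Incomparable b c → HasInduced P PosetD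
  induced-D {a} {b} {c} {d} {x} s t b∥c = induced G-D (lookup (a ∷ b ∷ c ∷ d ∷ x ∷ []))
    (λ { ab → Spans.a⊏b s ; bd → Spans.b⊏c s ; ac → Spans.a⊏b t ; cd → Spans.b⊏c t })
    ( (above (gen ab) ∷ above (gen ac) ∷ above (step (gen ab) (gen bd)) ∷ beside (a∥x s) ∷ [])
    ∷ (beside b∥c ∷ above (gen bd) ∷ beside (b∥x s) ∷ [])
    ∷ (above (gen cd) ∷ beside (b∥x t) ∷ [])
    ∷ (beside (c∥x s) ∷ [])
    ∷ []
    ∷ [])

  induced-Y : ∀ {a b c d x} → Spans _⋖_ a d b x → Spans _⋖_ a d c x → Incomparable b c → HasInduced P PosetY
  induced-Y {a} {b} {c} {d} {x} s t b∥c = induced G-Y (lookup (a ∷ b ∷ c ∷ d ∷ x ∷ []))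
    (λ { ad → Spans.a⊏b s ; db → Spans.b⊏c s ; dc → Spans.b⊏c t })
    ( (above (step (gen ad) (gen db)) ∷ above (step (gen ad) (gen dc)) ∷ above (gen ad) ∷ beside (a∥x s) ∷ [])
    ∷ (beside b∥c ∷ below (gen db) ∷ beside (c∥x s) ∷ [])
    ∷ (below (gen dc) ∷ beside (c∥x t) ∷ [])
    ∷ (beside (b∥x s) ∷ [])
    ∷ []
    ∷ [])

_ᵒᵖ : FinPoset → FinPoset
P ᵒᵖ = record
  { size   = size P
  ; _≺_    = flip (_≺_ P)
  ; irrefl = FinPoset.irrefl P
  ; trans  = flip (FinPoset.trans P)
  }

module _ (P : FinPoset) (F : FerrersOrder (_≺_ P)) where
  open FerrersOrder F
  open Induced P F
  private module ᵒᵖ = Induced (P ᵒᵖ) (flip-ferrers F)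

  -- This is `induced-Y` in the reversed poset; swapping the arguments of the equivalence returns to
  -- the original order.
  induced-Yᵈ : ∀ {a b c d x} → Spans (_≺_ P) b d a x → Spans (_≺_ P) c d a x → Incomparable b c → HasInduced P PosetYDual
  induced-Yᵈ s t (b≢c , b⋢c , c⋢b) with f , inj , iff ← ᵒᵖ.induced-Y (flip-spans s) (flip-spans t) (b≢c , c⋢b , b⋢c) =
    f , inj , λ i j → iff j i

  -- Two distinct middles, tops or bottoms of otherwise equal spans are either comparable, which
  -- lengthens the chain to a 4+1, or incomparable, which yields D, Y or the dual of Y.
  forbidden-free⇒span-axioms : ForbiddenFree P → SpanAxioms (_≺_ P)
  forbidden-free⇒span-axioms (no-4+1 , no-3+1+1 , no-Z , no-D , no-Y , no-Yᵈ) = record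
    { ferrersOrder   = F
    ; unchained      = chained⇒⊥
    ; spanner-unique = λ s t → decidable-stable (_ ≟ _) λ x≢y → no-3+1+1 (induced-3+1+1 s t x≢y)
    ; middle-unique  = λ s t → decidable-stable (_ ≟ _) λ b≢c → no-D (induced-D s t (b≢c , middle⋢ s t , middle⋢ t s))
    ; top-unique     = λ s t → decidable-stable (_ ≟ _) λ b≢c → no-Y (induced-Y s t (b≢c , top⋢ s t , top⋢ t s))
    ; bottom-unique  = λ s t → decidable-stable (_ ≟ _) λ b≢c → no-Yᵈ (induced-Yᵈ s t (b≢c , bottom⋢ s t , bottom⋢ t s))
    }
    where
    -- Either one of the spanners spans the whole chain from `a` to `d`, giving 4+1, or `x ⋖ d` and
    -- `a ⋖ y` complete a Z.
    chained⇒⊥ : ∀ {a b c d x y} → Spans (_≺_ P) a b c x → Spans (_≺_ P) b c d y → ⊥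
    chained⇒⊥ {a} {d = d} {x} {y} s@(spans a⊏b b⊏c a⋢x _) t@(spans _ c⊏d _ y⋢d) with x ⊏? d | a ⊏? y
    ... | yes x⊏d | yes a⊏y = no-Z (induced-Z s t x⊏d a⊏y)
    ... | no  x⋢d | _       = no-4+1 (induced-4+1 (spans a⊏b (⊏-trans b⊏c c⊏d) a⋢x x⋢d) b⊏c c⊏d)
    ... | _       | no  a⋢y = no-4+1 (induced-4+1 (spans a⊏b (⊏-trans b⊏c c⊏d) a⋢y y⋢d) b⊏c c⊏d)

    middle⋢ : ∀ {a b c d x} → Spans (_≺_ P) a b d x → Spans (_≺_ P) a c d x → ¬ _≺_ P b c
    middle⋢ s t b⊏c = no-4+1 (induced-4+1 s b⊏c (Spans.b⊏c t))

    top⋢ : ∀ {a b c d x} → Spans (_≺_ P) a d b x → Spans (_≺_ P) a d c x → ¬ _≺_ P b c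
    top⋢ s t b⊏c = no-4+1 (induced-4+1 t (Spans.b⊏c s) b⊏c)

    bottom⋢ : ∀ {a b c d x} → Spans (_≺_ P) b d a x → Spans (_≺_ P) c d a x → ¬ _≺_ P b c
    bottom⋢ (spans _ d⊏a b⋢x x⋢a) (spans c⊏d _ _ _) b⊏c =
      no-4+1 (induced-4+1 (spans b⊏c (⊏-trans c⊏d d⊏a) b⋢x x⋢a) c⊏d d⊏a)

-- The span axioms exclude the forbidden posets.

module _ {m} {G : Fin m → Fin m → Set} where

  -- Allows a path in the closure to be refuted by case analysis on the generators leaving its
  -- source.
  first-edge : ∀ {x y} → TC G x y → ∃[ z ] (G x z × (z ≡ y ⊎ TC G z y))
  first-edge (gen g) = _ , g , inj₁ refl
  first-edge (step s t) with first-edge s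
  ... | z , g , inj₁ refl = z , g , inj₂ t
  ... | z , g , inj₂ r    = z , g , inj₂ (step r t)

  last-edge : ∀ {x y} → TC G x y → ∃[ z ] G z y
  last-edge (gen g)    = _ , g
  last-edge (step _ t) = last-edge t

  no-out : ∀ {x} → (∀ {z} → ¬ G x z) → ∀ {y} → ¬ TC G x y
  no-out none p = none (proj₁ (proj₂ (first-edge p)))

  no-in : ∀ {y} → (∀ {z} → ¬ G z y) → ∀ {x} → ¬ TC G x y
  no-in none p = none (proj₂ (last-edge p))

module _ (P : FinPoset) (A : SpanAxioms (_≺_ P)) where
  open SpanAxioms A

  private
    spans-at : ∀ {m} {Q : Fin m → Fin m → Set} ((f , _) : HasInduced P Q) → ∀ {a b c x} →
      Q a b → Q b c → ¬ Q a x → ¬ Q x c → Spans (_≺_ P) (f a) (f b) (f c) (f x)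
    spans-at (f , _ , iff) p q r s =
      spans (to (iff _ _) p) (to (iff _ _) q) (r ∘ from (iff _ _)) (s ∘ from (iff _ _))

  span-axioms⇒forbidden-free : ForbiddenFree P
  span-axioms⇒forbidden-free =
      -- The single element `4F` spans both overlapping parts of the four-element chain.
      (λ h → unchained
        (spans-at h {x = 4F} (gen ab) (gen bc) (no-in λ ()) (no-out λ ()))
        (spans-at h {x = 4F} (gen bc) (gen cd) (no-in λ ()) (no-out λ ())))
    , (λ h@(_ , inj , _) → case inj 3F 4F (spanner-unique
        (spans-at h (gen ab) (gen bc) (no-in λ ()) (no-out λ ()))
        (spans-at h (gen ab) (gen bc) (no-in λ ()) (no-out λ ()))) of λ ())
    , (λ h → unchained
        (spans-at h (gen ab) (gen bc) (no-in λ ()) ¬x→c)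
        (spans-at h (gen bc) (gen cd) ¬b→y (no-out λ ())))
    , (λ h@(_ , inj , _) → case inj 1F 2F (middle-unique
        (spans-at h {x = 4F} (gen ab) (gen bd) (no-in λ ()) (no-out λ ()))
        (spans-at h {x = 4F} (gen ac) (gen cd) (no-in λ ()) (no-out λ ()))) of λ ())
    , (λ h@(_ , inj , _) → case inj 1F 2F (top-unique
        (spans-at h {x = 4F} (gen ad) (gen db) (no-in λ ()) (no-out λ ()))
        (spans-at h {x = 4F} (gen ad) (gen dc) (no-in λ ()) (no-out λ ()))) of λ ())
    -- The generators of Y are read backwards here: `1F` and `2F` are the bottoms and `0F` is the
    -- top.
    , (λ h@(_ , inj , _) → case inj 1F 2F (bottom-unique
        (spans-at h {x = 4F} (gen db) (gen ad) (no-out λ ()) (no-in λ ()))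
        (spans-at h {x = 4F} (gen dc) (gen ad) (no-out λ ()) (no-in λ ()))) of λ ())
    where
    ¬x→c : ¬ TC G-Z 4F 2F
    ¬x→c p with first-edge p
    ... | _ , xd , inj₂ q = no-out (λ ()) q

    ¬b→y : ¬ TC G-Z 1F 5F
    ¬b→y p with first-edge p
    ... | _ , bc , inj₂ q with first-edge q
    ...   | _ , cd , inj₂ r = no-out (λ ()) r

theorem12 : (P : FinPoset) → IsIntervalOrder P → TwinFree P →
    (IsUnitOCIntervalOrder P ⇔ IsStrictOCIntervalOrder P) ×
    (IsStrictOCIntervalOrder P ⇔ ForbiddenFree P)
theorem12 P interval twin-free =
  mk⇔ (unit⇒strict P) (forbidden-free⇒unit ∘ strict⇒forbidden-free) ,
  mk⇔ strict⇒forbidden-free (unit⇒strict P ∘ forbidden-free⇒unit)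
  where
  F : FerrersOrder (_≺_ P)
  F = interval⇒ferrers P interval

  strict⇒forbidden-free : IsStrictOCIntervalOrder P → ForbiddenFree P
  strict⇒forbidden-free (I , rep , strict) =
    span-axioms⇒forbidden-free P (strict⇒span-axioms P F twin-free I rep strict)

  forbidden-free⇒unit : ForbiddenFree P → IsUnitOCIntervalOrder P
  forbidden-free⇒unit free = span-axioms⇒unit P
    (forbidden-free⇒span-axioms P F free) (twin-free⇒connected P F twin-free)
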